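{- As $H\to\infty$, $$C_{\mathrm{constr}}(H)\gg H\log H,$$ where $C_{\mathrm{constr}}(H)$ is the number of pairs of integers $(p,r)$ with $p>r\ge 2$ such that the solution $A=\{\pm(pr-1),\pm(p+r)\}$, $B=\{\pm(pr+1),\pm(p-r)\}$ has height at most $H$.
   Context: For integers $p>r\ge2$, the four-element multisets $A=\{\pm(pr-1),\pm(p+r)\}$ and $B=\{\pm(pr+1),\pm(p-r)\}$ (where $\{\pm x,\pm y\}=\{x,-x,y,-y\}$) form a degree-three Prouhet--Tarry--Escott solution, i.e. have equal sums of $\ell$-th powers for $\ell=1,2,3$. The height of $(A,B)$ is $\max\{|a|,|b|:a\in A,\ b\in B\}$. Solutions are counted by parameter pairs $(p,r)$. The notation $f(H)\gg g(H)$ as $H\to\infty$ means that there are constants $\kappa>0$ and $H_0$ with $f(H)\ge \kappa\, g(H)$ for all $H\ge H_0$. -}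

module Defs where

open import Data.Nat as ℕ using (ℕ; zero; suc; s≤s)
import Data.Nat.Properties as ℕₚ
open import Data.Integer as ℤ using (ℤ; +_; ∣_∣; 1ℤ)
import Data.Integer.Properties as ℤₚ
open import Data.Integer.Tactic.RingSolver using (solve-∀)
open import Data.Rational as ℚ using (ℚ; 0ℚ; 1ℚ; _/_)
import Data.Rational.Properties as ℚₚ
import Data.Rational.Unnormalised as ℚᵘ
import Data.Rational.Unnormalised.Properties as ℚᵘₚ
open import Data.List using (List; []; _∷_; _++_; map; foldr; length; filter; upTo; cartesianProduct)
open import Data.List.Extrema.Nat using (max; xs≤max)
open import Data.List.Membership.Propositional using (_∈_)
open import Data.List.Membership.Propositional.Properties
  using (∈-++⁺ˡ; ∈-filter⁺; ∈-filter⁻; ∈-cartesianProduct⁺; ∈-map⁺; ∈-upTo⁺)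
import Data.List.Relation.Unary.All as All
open import Data.List.Relation.Unary.Any using (here; there)
open import Data.List.Relation.Unary.Unique.Propositional using (Unique)
import Data.List.Relation.Unary.Unique.Propositional.Properties as Uniqueₚ
open import Data.Product using (_×_; _,_; proj₁; proj₂; ∃-syntax)
open import Relation.Binary.PropositionalEquality using (_≡_; refl; sym; trans; cong; subst₂)
open import Relation.Nullary.Decidable using (_×-dec_)
open import Relation.Unary using (Decidable)

-- Multisets of integers are represented by lists; `powerSum` and `height`
-- do not depend on the order of the entries.

powerSum : ℕ → List ℤ → ℤ
powerSum ℓ xs = foldr ℤ._+_ (+ 0) (map (ℤ._^ ℓ) xs)

record PTESolution (d : ℕ) : Set where
  field
    A B        : List ℤ
    equalSize  : length A ≡ length B
    equalSums  : ∀ ℓ → 1 ℕ.≤ ℓ → ℓ ℕ.≤ d → powerSum ℓ A ≡ powerSum ℓ B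

height : ∀ {d} → PTESolution d → ℕ
height S = max 0 (map ∣_∣ (A ++ B))
  where open PTESolution S

±_,±_ : ℤ → ℤ → List ℤ
±_,±_ x y = x ∷ ℤ.- x ∷ y ∷ ℤ.- y ∷ []

private
  oddSum : ∀ ℓ → (∀ x → (ℤ.- x) ℤ.^ ℓ ≡ ℤ.- (x ℤ.^ ℓ)) → ∀ x y → powerSum ℓ (± x ,± y) ≡ + 0
  oddSum ℓ odd x y rewrite odd x | odd y = cancel (x ℤ.^ ℓ) (y ℤ.^ ℓ)
    where
    cancel : ∀ a c → a ℤ.+ (ℤ.- a ℤ.+ (c ℤ.+ (ℤ.- c ℤ.+ + 0))) ≡ + 0
    cancel = solve-∀

  odd₁ : ∀ x → (ℤ.- x) ℤ.* 1ℤ ≡ ℤ.- (x ℤ.* 1ℤ)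
  odd₁ = solve-∀

  odd₃ : ∀ x → (ℤ.- x) ℤ.* ((ℤ.- x) ℤ.* ((ℤ.- x) ℤ.* 1ℤ)) ≡ ℤ.- (x ℤ.* (x ℤ.* (x ℤ.* 1ℤ)))
  odd₃ = solve-∀

  sum₂ : ∀ x y → x ℤ.* (x ℤ.* 1ℤ) ℤ.+ ((ℤ.- x) ℤ.* ((ℤ.- x) ℤ.* 1ℤ)
    ℤ.+ (y ℤ.* (y ℤ.* 1ℤ) ℤ.+ ((ℤ.- y) ℤ.* ((ℤ.- y) ℤ.* 1ℤ) ℤ.+ (+ 0))))
    ≡ (+ 2) ℤ.* (x ℤ.* x ℤ.+ y ℤ.* y)
  sum₂ = solve-∀

  squares : ∀ p r →
    (p ℤ.* r ℤ.- 1ℤ) ℤ.* (p ℤ.* r ℤ.- 1ℤ) ℤ.+ (p ℤ.+ r) ℤ.* (p ℤ.+ r)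
    ≡ (p ℤ.* r ℤ.+ 1ℤ) ℤ.* (p ℤ.* r ℤ.+ 1ℤ) ℤ.+ (p ℤ.- r) ℤ.* (p ℤ.- r)
  squares = solve-∀

  -- Opaque: otherwise normalising `constr p r` unfolds the ring-solver proofs.
  opaque
    equalSums± : ∀ u v w z → u ℤ.* u ℤ.+ v ℤ.* v ≡ w ℤ.* w ℤ.+ z ℤ.* z →
      ∀ ℓ → 1 ℕ.≤ ℓ → ℓ ℕ.≤ 3 → powerSum ℓ (± u ,± v) ≡ powerSum ℓ (± w ,± z)
    equalSums± u v w z eq 1 _ _ = trans (oddSum 1 odd₁ u v) (sym (oddSum 1 odd₁ w z))
    equalSums± u v w z eq 2 _ _ = trans (sum₂ u v) (trans (cong ((+ 2) ℤ.*_) eq) (sym (sum₂ w z)))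
    equalSums± u v w z eq 3 _ _ = trans (oddSum 3 odd₃ u v) (sym (oddSum 3 odd₃ w z))
    equalSums± u v w z eq (suc (suc (suc (suc _)))) _ (s≤s (s≤s (s≤s ())))

constr : ℤ → ℤ → PTESolution 3
constr p r = record
  { A         = ± (p ℤ.* r ℤ.- 1ℤ) ,± (p ℤ.+ r)
  ; B         = ± (p ℤ.* r ℤ.+ 1ℤ) ,± (p ℤ.- r)
  ; equalSize = refl
  ; equalSums = equalSums± (p ℤ.* r ℤ.- 1ℤ) (p ℤ.+ r) (p ℤ.* r ℤ.+ 1ℤ) (p ℤ.- r) (squares p r)
  }

fromℕ : ℕ → ℚ
fromℕ n = + n / 1

-- The height bound H ranges over ℚ.  A bound for all rational H ≥ H₀ gives the
-- same bound, with the same constants, for all real H ≥ H₀, because the counting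
-- function is right-continuous in H.
Counted : ℚ → ℤ × ℤ → Set
Counted H (p , r) = p ℤ.> r × r ℤ.≥ + 2 × fromℕ (height (constr p r)) ℚ.≤ H

counted? : ∀ H → Decidable (Counted H)
counted? H (p , r) =
  (r ℤₚ.<? p) ×-dec ((+ 2) ℤₚ.≤? r) ×-dec (fromℕ (height (constr p r)) ℚₚ.≤? H)

-- The search range 0 ≤ p , r ≤ |numerator of H| loses no pair: see `∈-countedPairs⁺`.
range : ℚ → List ℤ
range H = map +_ (upTo (suc ∣ ℚ.↥ H ∣))

countedPairs : ℚ → List (ℤ × ℤ)
countedPairs H = filter (counted? H) (cartesianProduct (range H) (range H))

countedPairs-unique : ∀ H → Unique (countedPairs H)
countedPairs-unique H = Uniqueₚ.filter⁺ (counted? H) (Uniqueₚ.cartesianProduct⁺ u u)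
  where u = Uniqueₚ.map⁺ ℤₚ.+-injective (Uniqueₚ.upTo⁺ (suc ∣ ℚ.↥ H ∣))

∈-countedPairs⁻ : ∀ {H x} → x ∈ countedPairs H → Counted H x
∈-countedPairs⁻ {H} x∈ = proj₂ (∈-filter⁻ (counted? H) {xs = cartesianProduct (range H) (range H)} x∈)

private
  bound : ∀ n H → fromℕ n ℚ.≤ H → n ℕ.≤ ∣ ℚ.↥ H ∣
  bound n H@(ℚ.mkℚ a d-1 c) n≤H
    with ℚᵘₚ.≤-respˡ-≃ (ℚₚ.toℚᵘ-fromℚᵘ (ℚᵘ.mkℚᵘ (+ n) 0)) (ℚₚ.toℚᵘ-mono-≤ n≤H)
  ... | ℚᵘ.*≤* nd≤a = ℕₚ.≤-trans (ℕₚ.m≤m*n n (suc d-1)) (abs a (subst₂ ℤ._≤_ (sym (ℤₚ.pos-* n (suc d-1))) (ℤₚ.*-identityʳ a) nd≤a))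
    where
    abs : ∀ {m} a → + m ℤ.≤ a → m ℕ.≤ ∣ a ∣
    abs (+ _) (ℤ.+≤+ m≤a) = m≤a

  ∣A∣≤height : ∀ {d} (S : PTESolution d) {x} → x ∈ PTESolution.A S → ∣ x ∣ ℕ.≤ height S
  ∣A∣≤height S x∈A = All.lookup (xs≤max 0 _) (∈-map⁺ ∣_∣ (∈-++⁺ˡ x∈A))

∈-countedPairs⁺ : ∀ {H x} → Counted H x → x ∈ countedPairs H
∈-countedPairs⁺ {H} {+ p , + r} cx@(ℤ.+<+ r<p , _ , h≤H) =
  ∈-filter⁺ (counted? H) (∈-cartesianProduct⁺ (inRange p≤N) (inRange (ℕₚ.≤-trans (ℕₚ.<⇒≤ r<p) p≤N))) cx
  where
  p≤N : p ℕ.≤ ∣ ℚ.↥ H ∣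
  p≤N = ℕₚ.≤-trans (ℕₚ.m≤m+n p r)
    (ℕₚ.≤-trans (∣A∣≤height (constr (+ p) (+ r)) (there (there (here refl)))) (bound _ H h≤H))
  inRange : ∀ {n} → n ℕ.≤ ∣ ℚ.↥ H ∣ → + n ∈ range H
  inRange n≤N = ∈-map⁺ +_ (∈-upTo⁺ (s≤s n≤N))
∈-countedPairs⁺ {x = ℤ.-[1+ _ ] , + _ } (() , _)
∈-countedPairs⁺ {x = _ , ℤ.-[1+ _ ]} (_ , () , _)

C-constr : ℚ → ℕ
C-constr H = length (countedPairs H)

expTerm : ℚ → ℕ → ℚ
expTerm x zero    = 1ℚ
expTerm x (suc i) = expTerm x i ℚ.* x ℚ.* (+ 1 / suc i)

-- expSum x n = ∑_{i ≤ n} xⁱ / i!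
expSum : ℚ → ℕ → ℚ
expSum x zero    = expTerm x 0
expSum x (suc n) = expSum x n ℚ.+ expTerm x (suc n)

-- lim s ≤ y, for a convergent sequence s of rationals.
lim_≤_ : (ℕ → ℚ) → ℚ → Set
lim s ≤ y = ∀ ε → 0ℚ ℚ.< ε → ∃[ N ] (∀ n → N ℕ.≤ n → s n ℚ.≤ y ℚ.+ ε)

-- A real number is given by the set of rationals that are at most that number.
LowerReal : Set₁
LowerReal = ℚ → Set

-- The natural logarithm of H > 0, as the inverse of exp: q ≤ log H iff exp q ≤ H.
log : ℚ → LowerReal
log H q = lim (expSum q) ≤ H

-- Scaling by c.  This is multiplication of reals only for c > 0, which holds
-- wherever it is used below.
infixr 7 _·_
_·_ : ℚ → LowerReal → LowerReal
(c · x) y = ∃[ q ] (x q × y ℚ.≤ c ℚ.* q)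

infix 4 _≤ᴸ_
_≤ᴸ_ : LowerReal → ℚ → Set
x ≤ᴸ b = ∀ q → x q → q ℚ.≤ b

-- f(H) ≫ g(H) as H → ∞.  A positive real κ can always be decreased to a rational
-- one; H₀ > 0 restricts to the H for which log H makes sense.
infix 3 _≫_
_≫_ : (ℚ → ℕ) → (ℚ → LowerReal) → Set
f ≫ g = ∃[ κ ] ∃[ H₀ ] (0ℚ ℚ.< κ × 0ℚ ℚ.< H₀ ×
  (∀ H → H₀ ℚ.≤ H → κ · g H ≤ᴸ fromℕ (f H)))

{-# OPTIONS --safe #-}

-- The height is at most (r + 1) p.  For N = ⌊H⌋ and D a power of two with 8D² ≤ N, the pairs
-- with D ≤ r < 2D and ⌊N / 4D⌋ ≤ p < 2 ⌊N / 4D⌋ are therefore counted, and there are at least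
-- N / 8 of them.  If n = ⌊x / 16⌋ with exp x ≤ H, the n-th term of the exponential series gives
-- 16ⁿ ≤ H + 1, which for H ≥ 2048 leaves room for n + 1 dyadic values of D.  Hence
-- C(H) ≥ (n + 1) N / 8, while H x ≤ 2N · 16 (n + 1).

module Submission where

open import Defs
open import Data.Nat using (ℕ; zero; suc; _+_; _*_; _^_; _≤_; _<_; z≤n; s≤s; NonZero; _≤′_; ≤′-refl; ≤′-step)
open import Data.Nat.DivMod using (_/_; _%_; m≡m%n+[m/n]*n; m%n<n; m/n*n≤m; m≥n⇒m/n>0; m*n/n≡m; /-monoˡ-≤)
open import Data.Nat.Properties
open import Data.Nat.Tactic.RingSolver using (solve-∀)
open import Data.Integer as ℤ using (ℤ; +_; +≤+; +<+; ∣_∣)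
import Data.Integer.Properties as ℤ
open import Data.Rational as ℚ using (ℚ; 0ℚ; 1ℚ)
import Data.Rational.Properties as ℚ
open import Data.Rational.Unnormalised as ℚᵘ using (mkℚᵘ; *≤*; *<*; *≡*)
import Data.Rational.Unnormalised.Properties as ℚᵘ
open import Data.Empty using (⊥)
open import Data.Fin using (zero; suc)
open import Data.Fin.Properties using (injective⇒≤)
open import Data.List using (List; []; _∷_; _++_; length; map; lookup; applyUpTo; cartesianProduct)
open import Data.List.Extrema.Nat using (max≤v⁺)
open import Data.List.Membership.Propositional using (_∈_)
open import Data.List.Membership.Propositional.Properties
  using (∈-lookup; ∈-++⁻; ∈-applyUpTo⁻; ∈-cartesianProduct⁻)
open import Data.List.Properties using (length-++; length-map; length-applyUpTo)
open import Data.List.Relation.Binary.Subset.Propositional using (_⊆_)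
open import Data.List.Relation.Unary.All as All using (All; []; _∷_)
import Data.List.Relation.Unary.All.Properties as All
open import Data.List.Relation.Unary.AllPairs using ([]; _∷_)
open import Data.List.Relation.Unary.Any using (index)
open import Data.List.Relation.Unary.Any.Properties using (lookup-index)
open import Data.List.Relation.Unary.Unique.Propositional using (Unique)
import Data.List.Relation.Unary.Unique.Propositional.Properties as Unique
open import Data.Product using (_×_; _,_; ∃-syntax)
open import Data.Sum using ([_,_]′)
open import Relation.Binary.PropositionalEquality
open import Relation.Nullary using (contradiction)

-- Counting with repetition-free lists.

Unique⇒lookup-injective : ∀ {a} {A : Set a} {xs : List A} → Unique xs →
  ∀ {i j} → lookup xs i ≡ lookup xs j → i ≡ j
Unique⇒lookup-injective (_ ∷ _)   {zero}  {zero}  _  = refl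
Unique⇒lookup-injective (x∉ ∷ _)  {zero}  {suc j} eq = contradiction eq (All.lookup x∉ (∈-lookup j))
Unique⇒lookup-injective (x∉ ∷ _)  {suc i} {zero}  eq = contradiction (sym eq) (All.lookup x∉ (∈-lookup i))
Unique⇒lookup-injective (_ ∷ xs!) {suc i} {suc j} eq = cong suc (Unique⇒lookup-injective xs! eq)

-- Pigeonhole: sending an index of `xs` to the position of its entry in `ys` is injective, since
-- equal positions force equal entries and `xs` repeats none.
Unique∧⊆⇒length≤ : ∀ {a} {A : Set a} {xs ys : List A} → Unique xs → xs ⊆ ys → length xs ≤ length ys
Unique∧⊆⇒length≤ {xs = xs} {ys} xs! xs⊆ys = injective⇒≤ {f = position} λ {i} {j} eq →
  Unique⇒lookup-injective xs! (trans (at i) (trans (cong (lookup ys) eq) (sym (at j))))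
  where
  position = λ i → index (xs⊆ys (∈-lookup {xs = xs} i))
  at : ∀ i → lookup xs i ≡ lookup ys (position i)
  at i = lookup-index (xs⊆ys (∈-lookup {xs = xs} i))

-- Natural numbers inside the rationals, and integer parts.

toℚᵘ-fromℕ : ∀ n → ℚ.toℚᵘ (fromℕ n) ℚᵘ.≃ mkℚᵘ (+ n) 0
toℚᵘ-fromℕ n = ℚ.toℚᵘ-fromℚᵘ (mkℚᵘ (+ n) 0)

fromℕ-mono-≤ : ∀ {m n} → m ≤ n → fromℕ m ℚ.≤ fromℕ n
fromℕ-mono-≤ {m} {n} m≤n = ℚ.toℚᵘ-cancel-≤
  (ℚᵘ.≤-respˡ-≃ (ℚᵘ.≃-sym (toℚᵘ-fromℕ m)) (ℚᵘ.≤-respʳ-≃ (ℚᵘ.≃-sym (toℚᵘ-fromℕ n))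
    (*≤* (ℤ.*-monoʳ-≤-nonNeg (+ 1) (+≤+ m≤n)))))

fromℕ-cancel-< : ∀ {m n} → fromℕ m ℚ.< fromℕ n → m < n
fromℕ-cancel-< {m} {n} m<n = ≰⇒> λ n≤m → ℚ.<-irrefl refl (ℚ.<-≤-trans m<n (fromℕ-mono-≤ {n} {m} n≤m))

fromℕ-nonNeg : ∀ n → 0ℚ ℚ.≤ fromℕ n
fromℕ-nonNeg n = fromℕ-mono-≤ {0} {n} z≤n

fromℕ-+ : ∀ m n → fromℕ (m + n) ≡ fromℕ m ℚ.+ fromℕ n
fromℕ-+ m n = ℚ.toℚᵘ-injective (begin-equality
  ℚ.toℚᵘ (fromℕ (m + n))                     ≃⟨ toℚᵘ-fromℕ (m + n) ⟩
  mkℚᵘ (+ (m + n)) 0                         ≃⟨ *≡* (cong (ℤ._* + 1) (sym (cong₂ ℤ._+_ (ℤ.*-identityʳ (+ m)) (ℤ.*-identityʳ (+ n))))) ⟩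
  mkℚᵘ (+ m) 0 ℚᵘ.+ mkℚᵘ (+ n) 0             ≃⟨ ℚᵘ.+-cong (toℚᵘ-fromℕ m) (toℚᵘ-fromℕ n) ⟨
  ℚ.toℚᵘ (fromℕ m) ℚᵘ.+ ℚ.toℚᵘ (fromℕ n)     ≃⟨ ℚ.toℚᵘ-homo-+ (fromℕ m) (fromℕ n) ⟨
  ℚ.toℚᵘ (fromℕ m ℚ.+ fromℕ n)               ∎)
  where open ℚᵘ.≤-Reasoning

fromℕ-* : ∀ m n → fromℕ (m * n) ≡ fromℕ m ℚ.* fromℕ n
fromℕ-* m n = ℚ.toℚᵘ-injective (begin-equality
  ℚ.toℚᵘ (fromℕ (m * n))                     ≃⟨ toℚᵘ-fromℕ (m * n) ⟩
  mkℚᵘ (+ (m * n)) 0                         ≃⟨ *≡* (cong (ℤ._* + 1) (ℤ.pos-* m n)) ⟩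
  mkℚᵘ (+ m) 0 ℚᵘ.* mkℚᵘ (+ n) 0             ≃⟨ ℚᵘ.*-cong (toℚᵘ-fromℕ m) (toℚᵘ-fromℕ n) ⟨
  ℚ.toℚᵘ (fromℕ m) ℚᵘ.* ℚ.toℚᵘ (fromℕ n)     ≃⟨ ℚ.toℚᵘ-homo-* (fromℕ m) (fromℕ n) ⟨
  ℚ.toℚᵘ (fromℕ m ℚ.* fromℕ n)               ∎)
  where open ℚᵘ.≤-Reasoning

[1+n]*1/[1+n]≡1 : ∀ n → fromℕ (suc n) ℚ.* (+ 1 ℚ./ suc n) ≡ 1ℚ
[1+n]*1/[1+n]≡1 n = ℚ.toℚᵘ-injective (begin-equality
  ℚ.toℚᵘ (fromℕ (suc n) ℚ.* (+ 1 ℚ./ suc n))           ≃⟨ ℚ.toℚᵘ-homo-* (fromℕ (suc n)) (+ 1 ℚ./ suc n) ⟩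
  ℚ.toℚᵘ (fromℕ (suc n)) ℚᵘ.* ℚ.toℚᵘ (+ 1 ℚ./ suc n)   ≃⟨ ℚᵘ.*-cong (toℚᵘ-fromℕ (suc n)) (ℚ.toℚᵘ-fromℚᵘ (mkℚᵘ (+ 1) n)) ⟩
  mkℚᵘ (+ suc n) 0 ℚᵘ.* mkℚᵘ (+ 1) n                   ≃⟨ *≡* (cong +_ (lemma n)) ⟩
  mkℚᵘ (+ 1) 0                                         ∎)
  where
  open ℚᵘ.≤-Reasoning
  lemma : ∀ n → suc n * 1 * 1 ≡ 1 * (1 * suc n)
  lemma = solve-∀

*-mono-≤-nonNeg : ∀ {p q r s} → 0ℚ ℚ.≤ p → 0ℚ ℚ.≤ s → p ℚ.≤ q → r ℚ.≤ s → p ℚ.* r ℚ.≤ q ℚ.* s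
*-mono-≤-nonNeg {p} {q} {r} {s} 0≤p 0≤s p≤q r≤s = ℚ.≤-trans
  (ℚ.*-monoˡ-≤-nonNeg p {{ℚ.nonNegative 0≤p}} r≤s) (ℚ.*-monoʳ-≤-nonNeg s {{ℚ.nonNegative 0≤s}} p≤q)

*-nonNeg : ∀ {p q} → 0ℚ ℚ.≤ p → 0ℚ ℚ.≤ q → 0ℚ ℚ.≤ p ℚ.* q
*-nonNeg {p} {q} 0≤p 0≤q =
  ℚ.nonNegative⁻¹ (p ℚ.* q) {{ℚ.nonNeg*nonNeg⇒nonNeg p {{ℚ.nonNegative 0≤p}} q {{ℚ.nonNegative 0≤q}}}}

-- Euclidean division of the numerator by the denominator; the remainder being smaller than the
-- denominator gives the strict upper bound.
⌊_⌋-exists : ∀ x → 0ℚ ℚ.≤ x → ∃[ n ] fromℕ n ℚ.≤ x × x ℚ.< fromℕ (suc n)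
⌊ ℚ.mkℚ (+ a) d-1 c ⌋-exists _ = n , lower , upper
  where
  d = suc d-1
  n = a / d
  lower : fromℕ n ℚ.≤ ℚ.mkℚ (+ a) d-1 c
  lower = ℚ.toℚᵘ-cancel-≤ (ℚᵘ.≤-respˡ-≃ (ℚᵘ.≃-sym (toℚᵘ-fromℕ n))
    (*≤* (subst₂ ℤ._≤_ (ℤ.pos-* n d) (sym (ℤ.*-identityʳ (+ a))) (+≤+ (m/n*n≤m a d)))))
  a<[1+n]d : a < suc n * d
  a<[1+n]d = subst (_< suc n * d) (sym (m≡m%n+[m/n]*n a d)) (+-monoˡ-< (n * d) (m%n<n a d))
  upper : ℚ.mkℚ (+ a) d-1 c ℚ.< fromℕ (suc n)
  upper = ℚ.toℚᵘ-cancel-< (ℚᵘ.<-respʳ-≃ (ℚᵘ.≃-sym (toℚᵘ-fromℕ (suc n)))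
    (*<* (subst₂ ℤ._<_ (sym (ℤ.*-identityʳ (+ a))) (ℤ.pos-* (suc n) d) (+<+ a<[1+n]d))))
⌊ ℚ.mkℚ ℤ.-[1+ _ ] _ _ ⌋-exists (ℚ.*≤* ())

-- Auxiliary facts on lengths, powers and division.

length-cartesianProduct : ∀ {a b} {A : Set a} {B : Set b} (xs : List A) (ys : List B) →
  length (cartesianProduct xs ys) ≡ length xs * length ys
length-cartesianProduct []       ys = refl
length-cartesianProduct (x ∷ xs) ys = trans (length-++ (map (x ,_) ys))
  (cong₂ _+_ (length-map (x ,_) ys) (length-cartesianProduct xs ys))

^-distribʳ-* : ∀ m n o → (m * n) ^ o ≡ m ^ o * n ^ o
^-distribʳ-* m n zero    = refl
^-distribʳ-* m n (suc o) =
  trans (cong (m * n *_) (^-distribʳ-* m n o)) (*-interchange m n (m ^ o) (n ^ o))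
  where
  *-interchange : ∀ a b c d → a * b * (c * d) ≡ a * c * (b * d)
  *-interchange = solve-∀

-- The remainder is less than `n`, and `n` is at most `(m / n) * n` because the quotient is
-- positive. Rounding down thus costs at most a factor 2.
m<2[m/n]n : ∀ m n .{{_ : NonZero n}} → n ≤ m → m < 2 * ((m / n) * n)
m<2[m/n]n m n n≤m = begin-strict
  m                         ≡⟨ m≡m%n+[m/n]*n m n ⟩
  m % n + (m / n) * n       <⟨ +-monoˡ-< ((m / n) * n) (m%n<n m n) ⟩
  n + (m / n) * n           ≤⟨ +-monoˡ-≤ ((m / n) * n) (≤-trans (≤-reflexive (sym (*-identityˡ n))) (*-monoˡ-≤ n (m≥n⇒m/n>0 n≤m))) ⟩
  (m / n) * n + (m / n) * n ≡⟨ double ((m / n) * n) ⟩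
  2 * ((m / n) * n)         ∎
  where
  open ≤-Reasoning
  double : ∀ k → k + k ≡ 2 * k
  double = solve-∀

-- The height of a constructed solution.

height≤ : ∀ {d} (S : PTESolution d) {v} →
  All (λ x → ∣ x ∣ ≤ v) (PTESolution.A S ++ PTESolution.B S) → height S ≤ v
height≤ S {v} bounded = max≤v⁺ {v} {0} {map ∣_∣ (PTESolution.A S ++ PTESolution.B S)} z≤n (All.map⁺ bounded)

-- By the triangle inequality every entry is at most `pr + 1` or `p + r` in absolute value; the
-- first uses `1 ≤ p`, the second `r ≤ pr`.
height-constr≤ : ∀ p r → 1 ≤ p → 1 ≤ r → height (constr (+ p) (+ r)) ≤ p * r + p
height-constr≤ p r 1≤p 1≤r =
  height≤ (constr (+ p) (+ r)) (pr-1 ∷ neg (+ p ℤ.* + r ℤ.- + 1) pr-1 ∷ p+r ∷ neg (+ p ℤ.+ + r) p+r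
    ∷ pr+1 ∷ neg (+ p ℤ.* + r ℤ.+ + 1) pr+1 ∷ p-r ∷ neg (+ p ℤ.- + r) p-r ∷ [])
  where
  open ≤-Reasoning
  neg : ∀ i {n} → ∣ i ∣ ≤ n → ∣ ℤ.- i ∣ ≤ n
  neg i i≤n = ≤-trans (≤-reflexive (ℤ.∣-i∣≡∣i∣ i)) i≤n

  ∣pr∣+1≤ : ∣ + p ℤ.* + r ∣ + 1 ≤ p * r + p
  ∣pr∣+1≤ = +-mono-≤ (≤-reflexive (ℤ.abs-* (+ p) (+ r))) 1≤p

  pr-1 : ∣ + p ℤ.* + r ℤ.- + 1 ∣ ≤ p * r + p
  pr-1 = ≤-trans (ℤ.∣i-j∣≤∣i∣+∣j∣ (+ p ℤ.* + r) (+ 1)) ∣pr∣+1≤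

  pr+1 : ∣ + p ℤ.* + r ℤ.+ + 1 ∣ ≤ p * r + p
  pr+1 = ≤-trans (ℤ.∣i+j∣≤∣i∣+∣j∣ (+ p ℤ.* + r) (+ 1)) ∣pr∣+1≤

  p+r : p + r ≤ p * r + p
  p+r = begin
    p + r     ≡⟨ +-comm p r ⟩
    r + p     ≡⟨ cong (_+ p) (*-identityˡ r) ⟨
    1 * r + p ≤⟨ +-monoˡ-≤ p (*-monoˡ-≤ r 1≤p) ⟩
    p * r + p ∎

  p-r : ∣ + p ℤ.- + r ∣ ≤ p * r + p
  p-r = ≤-trans (ℤ.∣i-j∣≤∣i∣+∣j∣ (+ p) (+ r)) p+r

-- Dyadic rectangles of parameter pairs.

interval : ℕ → ℕ → List ℤ
interval s n = applyUpTo (λ i → + (s + i)) n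

interval-unique : ∀ s n → Unique (interval s n)
interval-unique s n = Unique.applyUpTo⁺₁ _ n
  λ i<j _ eq → <⇒≢ i<j (+-cancelˡ-≡ s _ _ (ℤ.+-injective eq))

∈-interval⁻ : ∀ {s n z} → z ∈ interval s n → ∃[ k ] z ≡ + k × s ≤ k × k < s + n
∈-interval⁻ {s} z∈ with ∈-applyUpTo⁻ _ z∈
... | i , i<n , refl = s + i , refl , m≤m+n s i , +-monoʳ-< s i<n

∈-rectangle⁻ : ∀ {s m t n z w} → (z , w) ∈ cartesianProduct (interval s m) (interval t n) →
  ∃[ p ] ∃[ r ] z ≡ + p × w ≡ + r × s ≤ p × p < s + m × t ≤ r × r < t + n
∈-rectangle⁻ {s} {m} {t} {n} zw∈ with ∈-cartesianProduct⁻ (interval s m) (interval t n) zw∈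
... | z∈ , w∈ with ∈-interval⁻ z∈ | ∈-interval⁻ w∈
... | p , z≡p , s≤p , p<s+m | r , w≡r , t≤r , r<t+n =
  p , r , z≡p , w≡r , s≤p , p<s+m , t≤r , r<t+n

-- The exponent starts at 1, so that `D j` is at least 2 and `2 ≤ r` holds in every rectangle.
D : ℕ → ℕ
D j = 2 ^ suc j

4D-nonZero : ∀ j → NonZero (4 * D j)
4D-nonZero j = m*n≢0 4 (D j) {{_}} {{m^n≢0 2 (suc j)}}

-- The largest `q` with `2q * 2D ≤ N`, so that the far corner of the rectangle stays within the
-- height bound.
Q : ℕ → ℕ → ℕ
Q N j = (N / (4 * D j)) {{4D-nonZero j}}

block : ℕ → ℕ → List (ℤ × ℤ)
block N j = cartesianProduct (interval (Q N j) (Q N j)) (interval (D j) (D j))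

block-unique : ∀ N j → Unique (block N j)
block-unique N j = Unique.cartesianProduct⁺ (interval-unique (Q N j) (Q N j)) (interval-unique (D j) (D j))

-- This is 8D² ≤ N, so that 2D ≤ Q.
Wide : ℕ → ℕ → Set
Wide N j = 32 * 4 ^ j ≤ N

8D²≡32*4^j : ∀ j → 2 * D j * (4 * D j) ≡ 32 * 4 ^ j
8D²≡32*4^j j = trans (lemma (2 ^ j)) (cong (32 *_) (sym (^-distribʳ-* 2 2 j)))
  where
  lemma : ∀ x → 2 * (2 * x) * (4 * (2 * x)) ≡ 32 * (x * x)
  lemma = solve-∀

∈-block⁻ : ∀ {N j z w} → (z , w) ∈ block N j →
  ∃[ p ] ∃[ r ] z ≡ + p × w ≡ + r × Q N j ≤ p × p < Q N j + Q N j × D j ≤ r × r < D j + D j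
∈-block⁻ = ∈-rectangle⁻

D+D≡2D : ∀ j → D j + D j ≡ D (suc j)
D+D≡2D j = cong (λ d → D j + d) (sym (+-identityʳ (D j)))

-- Division of `8D² ≤ N` by `4D`. This places all values of `r` in the rectangle below all values of
-- `p`.
2D≤Q : ∀ {N j} → Wide N j → 2 * D j ≤ Q N j
2D≤Q {N} {j} wide = begin
  2 * D j                         ≡⟨ m*n/n≡m (2 * D j) (4 * D j) ⟨
  2 * D j * (4 * D j) / (4 * D j) ≤⟨ /-monoˡ-≤ (4 * D j) (≤-trans (≤-reflexive (8D²≡32*4^j j)) wide) ⟩
  Q N j                           ∎
  where
  open ≤-Reasoning
  instance _ = 4D-nonZero j

-- Matching by `with` is avoided on goals mentioning `Counted`: it would normalise `height (constr p r)`, which is huge.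
block-counted : ∀ {N j H} → Wide N j → fromℕ N ℚ.≤ H →
  ∀ {x} → x ∈ block N j → Counted H x
block-counted {N} {j} {H} wide N≤H x∈ = counted (∈-block⁻ {N} {j} x∈)
  where
  module _ {p r} (Q≤p : Q N j ≤ p) (p<2Q : p < Q N j + Q N j) (D≤r : D j ≤ r) (r<D+D : r < D j + D j) where
    open ≤-Reasoning

    r<2D : r < 2 * D j
    r<2D = <-≤-trans r<D+D (≤-reflexive (D+D≡2D j))

    r<p : r < p
    r<p = <-≤-trans r<2D (≤-trans (2D≤Q {N} {j} wide) Q≤p)

    2≤r : 2 ≤ r
    2≤r = ≤-trans (^-monoʳ-≤ 2 (s≤s (z≤n {j}))) D≤r

    regroup : ∀ q d → (q + q) * (2 * d) ≡ q * (4 * d)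
    regroup = solve-∀

    pr+p≤N : p * r + p ≤ N
    pr+p≤N = begin
      p * r + p                   ≡⟨ +-comm (p * r) p ⟩
      p + p * r                   ≡⟨ *-suc p r ⟨
      -- Strictness of `r < 2D` means `r + 1 ≤ 2D`, which absorbs the extra summand `p` of the
      -- height bound.
      p * suc r                   ≤⟨ *-mono-≤ (<⇒≤ p<2Q) r<2D ⟩
      (Q N j + Q N j) * (2 * D j) ≡⟨ regroup (Q N j) (D j) ⟩
      Q N j * (4 * D j)           ≤⟨ m/n*n≤m N (4 * D j) {{4D-nonZero j}} ⟩
      N                           ∎

    height≤N : height (constr (+ p) (+ r)) ≤ N
    height≤N = ≤-trans (height-constr≤ p r (≤-trans (s≤s z≤n) r<p) (<⇒≤ 2≤r)) pr+p≤N

  counted : ∀ {z w} → ∃[ p ] ∃[ r ] z ≡ + p × w ≡ + r × Q N j ≤ p × p < Q N j + Q N j × D j ≤ r × r < D j + D j →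
    Counted H (z , w)
  counted (p , r , refl , refl , Q≤p , p<2Q , D≤r , r<D+D) =
    +<+ (r<p Q≤p p<2Q D≤r r<D+D) , +≤+ (2≤r Q≤p p<2Q D≤r r<D+D) ,
    ℚ.≤-trans {fromℕ (height (constr (+ p) (+ r)))} {fromℕ N}
      (fromℕ-mono-≤ {height (constr (+ p) (+ r))} {N} (height≤N Q≤p p<2Q D≤r r<D+D)) N≤H

-- The rectangle has `Q * D` points, and `Q * 4D` is within a factor 2 of `N`; hence 8,
-- independently of the scale `j`.
N≤8*length-block : ∀ N j → Wide N j → N ≤ 8 * length (block N j)
N≤8*length-block N j wide = begin
  N                         ≤⟨ <⇒≤ (m<2[m/n]n N (4 * D j) {{4D-nonZero j}} 4D≤N) ⟩
  2 * (Q N j * (4 * D j))   ≡⟨ regroup (Q N j) (D j) ⟩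
  8 * (Q N j * D j)         ≡⟨ cong (8 *_) (sym length-block) ⟩
  8 * length (block N j)    ∎
  where
  open ≤-Reasoning
  regroup : ∀ q d → 2 * (q * (4 * d)) ≡ 8 * (q * d)
  regroup = solve-∀
  length-block : length (block N j) ≡ Q N j * D j
  length-block = trans (length-cartesianProduct (interval (Q N j) (Q N j)) (interval (D j) (D j)))
    (cong₂ _*_ (length-applyUpTo _ (Q N j)) (length-applyUpTo _ (D j)))
  4D≤N : 4 * D j ≤ N
  4D≤N = begin
    4 * D j             ≤⟨ m≤n*m (4 * D j) (2 * D j) {{m*n≢0 2 (D j) {{_}} {{m^n≢0 2 (suc j)}}}} ⟩
    2 * D j * (4 * D j) ≡⟨ 8D²≡32*4^j j ⟩
    32 * 4 ^ j          ≤⟨ wide ⟩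
    N                   ∎

-- The union of the rectangles and its size.

blocks : ℕ → ℕ → List (ℤ × ℤ)
blocks N zero    = block N zero
blocks N (suc n) = block N (suc n) ++ blocks N n

∈-blocks⁻ : ∀ N n {x} → x ∈ blocks N n → ∃[ j ] j ≤ n × x ∈ block N j
∈-blocks⁻ N zero    x∈ = zero , z≤n , x∈
∈-blocks⁻ N (suc n) x∈ = [ (λ x∈block → suc n , ≤-refl , x∈block) , earlier ]′ (∈-++⁻ (block N (suc n)) x∈)
  where
  earlier : ∀ {x} → x ∈ blocks N n → ∃[ j ] j ≤ suc n × x ∈ block N j
  earlier x∈blocks = let j , j≤n , x∈block = ∈-blocks⁻ N n x∈blocks in j , m≤n⇒m≤1+n j≤n , x∈block

-- Different scales are separated by the coordinate `r` alone: the range at scale `j ≤ n` ends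
-- before `D (suc j)`, which is at most the start `D (suc n)` of the new range.
blocks-unique : ∀ N n → Unique (blocks N n)
blocks-unique N zero    = block-unique N zero
blocks-unique N (suc n) = Unique.++⁺ (block-unique N (suc n)) (blocks-unique N n) λ (x∈ , x∈′) → disjoint x∈ x∈′
  where
  disjoint : ∀ {x} → x ∈ block N (suc n) → x ∈ blocks N n → ⊥
  disjoint x∈ x∈′ =
    let j , j≤n , x∈block = ∈-blocks⁻ N n x∈′
        _ , r  , _ , w≡r  , _ , _ , D≤r , _      = ∈-block⁻ {N} {suc n} x∈
        _ , r′ , _ , w≡r′ , _ , _ , _   , r′<D+D = ∈-block⁻ {N} {j} x∈block
    in <-irrefl (ℤ.+-injective (trans (sym w≡r′) w≡r)) (begin-strict
      r′        <⟨ r′<D+D ⟩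
      D j + D j ≡⟨ D+D≡2D j ⟩
      D (suc j) ≤⟨ ^-monoʳ-≤ 2 (s≤s (s≤s j≤n)) ⟩
      D (suc n) ≤⟨ D≤r ⟩
      r         ∎)
    where open ≤-Reasoning

Wide-mono : ∀ {N j n} → j ≤ n → Wide N n → Wide N j
Wide-mono j≤n = ≤-trans (*-monoʳ-≤ 32 (^-monoʳ-≤ 4 j≤n))

-- Each of the `n + 1` scales contributes at least `N / 8` pairs, which is the source of the
-- logarithm. `Wide` at the largest scale passes to all smaller ones.
[1+n]N≤8*length-blocks : ∀ N n → Wide N n → suc n * N ≤ 8 * length (blocks N n)
[1+n]N≤8*length-blocks N zero    wide = ≤-trans (≤-reflexive (*-identityˡ N)) (N≤8*length-block N 0 wide)
[1+n]N≤8*length-blocks N (suc n) wide = begin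
  N + suc n * N                                               ≤⟨ +-mono-≤ (N≤8*length-block N (suc n) wide)
                                                                   ([1+n]N≤8*length-blocks N n (Wide-mono {N} (n≤1+n n) wide)) ⟩
  8 * length (block N (suc n)) + 8 * length (blocks N n)      ≡⟨ *-distribˡ-+ 8 (length (block N (suc n))) (length (blocks N n)) ⟨
  8 * (length (block N (suc n)) + length (blocks N n))        ≡⟨ cong (8 *_) (length-++ (block N (suc n))) ⟨
  8 * length (blocks N (suc n))                               ∎
  where open ≤-Reasoning

[1+n]N≤8*C-constr : ∀ {H} N n → Wide N n → fromℕ N ℚ.≤ H → suc n * N ≤ 8 * C-constr H
[1+n]N≤8*C-constr {H} N n wide N≤H = ≤-trans ([1+n]N≤8*length-blocks N n wide)
  (*-monoʳ-≤ 8 (Unique∧⊆⇒length≤ (blocks-unique N n) counted))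
  where
  counted : blocks N n ⊆ countedPairs H
  counted x∈ = let j , j≤n , x∈block = ∈-blocks⁻ N n x∈ in
    ∈-countedPairs⁺ (block-counted {N} {j} (Wide-mono {N} j≤n wide) N≤H x∈block)

-- The exponential series and the logarithm.

0≤1/[1+n] : ∀ n → 0ℚ ℚ.≤ + 1 ℚ./ suc n
0≤1/[1+n] n = ℚ.nonNegative⁻¹ (+ 1 ℚ./ suc n) {{ℚ.normalize-nonNeg 1 (suc n)}}

expTerm-nonNeg : ∀ {x} → 0ℚ ℚ.≤ x → ∀ i → 0ℚ ℚ.≤ expTerm x i
expTerm-nonNeg 0≤x zero    = fromℕ-nonNeg 1
expTerm-nonNeg 0≤x (suc i) = *-nonNeg (*-nonNeg (expTerm-nonNeg 0≤x i) 0≤x) (0≤1/[1+n] i)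

expSum-nonNeg : ∀ {x} → 0ℚ ℚ.≤ x → ∀ n → 0ℚ ℚ.≤ expSum x n
expSum-nonNeg 0≤x zero    = fromℕ-nonNeg 1
expSum-nonNeg 0≤x (suc n) = ℚ.+-mono-≤ (expSum-nonNeg 0≤x n) (expTerm-nonNeg 0≤x (suc n))

expTerm≤expSum : ∀ {x} → 0ℚ ℚ.≤ x → ∀ n → expTerm x n ℚ.≤ expSum x n
expTerm≤expSum 0≤x zero    = ℚ.≤-refl
expTerm≤expSum 0≤x (suc n) =
  ℚ.≤-trans (ℚ.≤-reflexive (sym (ℚ.+-identityˡ _))) (ℚ.+-monoˡ-≤ _ (expSum-nonNeg 0≤x n))

expSum-mono-≤ : ∀ {x m n} → 0ℚ ℚ.≤ x → m ≤ n → expSum x m ℚ.≤ expSum x n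
expSum-mono-≤ {x} {m} 0≤x m≤n = go (≤⇒≤′ m≤n)
  where
  go : ∀ {n} → m ≤′ n → expSum x m ℚ.≤ expSum x n
  go ≤′-refl           = ℚ.≤-refl
  go (≤′-step {n} m≤n) = ℚ.≤-trans (go m≤n)
    (ℚ.≤-trans (ℚ.≤-reflexive (sym (ℚ.+-identityʳ _))) (ℚ.+-monoʳ-≤ (expSum x n) (expTerm-nonNeg 0≤x (suc n))))

-- Each of the factors x / k with k ≤ n of expTerm x n is at least c.
c^i≤expTerm : ∀ {x} c n → fromℕ (c * n) ℚ.≤ x → ∀ {i} → i ≤ n → fromℕ (c ^ i) ℚ.≤ expTerm x i
c^i≤expTerm c n cn≤x {zero}  _   = ℚ.≤-refl
c^i≤expTerm {x} c n cn≤x {suc i} i<n = begin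
  fromℕ (c ^ suc i)                                                   ≡⟨ ℚ.*-identityʳ _ ⟨
  fromℕ (c ^ suc i) ℚ.* 1ℚ                                            ≡⟨ cong₂ ℚ._*_ (trans (cong fromℕ (*-comm c (c ^ i))) (fromℕ-* (c ^ i) c)) (sym ([1+n]*1/[1+n]≡1 i)) ⟩
  (fromℕ (c ^ i) ℚ.* fromℕ c) ℚ.* (fromℕ (suc i) ℚ.* (+ 1 ℚ./ suc i)) ≡⟨ ℚ.*-assoc (fromℕ (c ^ i) ℚ.* fromℕ c) (fromℕ (suc i)) (+ 1 ℚ./ suc i) ⟨
  fromℕ (c ^ i) ℚ.* fromℕ c ℚ.* fromℕ (suc i) ℚ.* (+ 1 ℚ./ suc i)     ≡⟨ cong (ℚ._* (+ 1 ℚ./ suc i)) (ℚ.*-assoc (fromℕ (c ^ i)) (fromℕ c) (fromℕ (suc i))) ⟩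
  fromℕ (c ^ i) ℚ.* (fromℕ c ℚ.* fromℕ (suc i)) ℚ.* (+ 1 ℚ./ suc i)   ≡⟨ cong (λ y → fromℕ (c ^ i) ℚ.* y ℚ.* (+ 1 ℚ./ suc i)) (fromℕ-* c (suc i)) ⟨
  fromℕ (c ^ i) ℚ.* fromℕ (c * suc i) ℚ.* (+ 1 ℚ./ suc i)             ≤⟨ ℚ.*-monoʳ-≤-nonNeg (+ 1 ℚ./ suc i) {{ℚ.nonNegative (0≤1/[1+n] i)}}
                                                                           (*-mono-≤-nonNeg (fromℕ-nonNeg (c ^ i)) 0≤x (c^i≤expTerm c n cn≤x (<⇒≤ i<n))
                                                                             (ℚ.≤-trans (fromℕ-mono-≤ {c * suc i} {c * n} (*-monoʳ-≤ c i<n)) cn≤x)) ⟩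
  expTerm x (suc i)                                                   ∎
  where
  open ℚ.≤-Reasoning
  0≤x = ℚ.≤-trans (fromℕ-nonNeg (c * n)) cn≤x

-- Partial sums of nonnegative terms dominate their `n`-th term, which is at least `c ^ n`. The
-- summand 1 is the tolerance at which the limit is tested.
log⇒c^n≤H+1 : ∀ {H x} c n → fromℕ (c * n) ℚ.≤ x → log H x → fromℕ (c ^ n) ℚ.≤ H ℚ.+ 1ℚ
log⇒c^n≤H+1 {H} {x} c n cn≤x logH with logH 1ℚ (ℚ.positive⁻¹ 1ℚ)
... | M , bounded = begin
  fromℕ (c ^ n)     ≤⟨ c^i≤expTerm c n cn≤x ≤-refl ⟩
  expTerm x n       ≤⟨ expTerm≤expSum 0≤x n ⟩
  -- The index `M + n` is large enough both for the limit bound to apply and for the sum to contain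
  -- the `n`-th term.
  expSum x n        ≤⟨ expSum-mono-≤ 0≤x (m≤n+m n M) ⟩
  expSum x (M + n)  ≤⟨ bounded (M + n) (m≤m+n M n) ⟩
  H ℚ.+ 1ℚ          ∎
  where
  open ℚ.≤-Reasoning
  0≤x = ℚ.≤-trans (fromℕ-nonNeg (c * n)) cn≤x

-- Squaring turns `4 ^ n` into `16 ^ n`, which is why base 16 is used: if `N < 32 * 4 ^ n`, then `N²
-- < 1024 * 16 ^ n ≤ 1024 (N + 1) ≤ 2048 N ≤ N²`.
16^n≤1+N⇒Wide : ∀ N n → 2048 ≤ N → 16 ^ n ≤ suc N → Wide N n
16^n≤1+N⇒Wide N n 2048≤N 16^n≤1+N = ≮⇒≥ λ N<32*4^n → <⇒≱ (*-mono-< N<32*4^n N<32*4^n) (begin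
  32 * 4 ^ n * (32 * 4 ^ n) ≡⟨ regroup (4 ^ n) ⟩
  1024 * (4 ^ n * 4 ^ n)    ≡⟨ cong (1024 *_) (^-distribʳ-* 4 4 n) ⟨
  1024 * 16 ^ n             ≤⟨ *-monoʳ-≤ 1024 16^n≤1+N ⟩
  1024 * (1 + N)            ≤⟨ *-monoʳ-≤ 1024 (+-monoˡ-≤ N (≤-trans (s≤s z≤n) 2048≤N)) ⟩
  1024 * (N + N)            ≡⟨ double N ⟩
  2048 * N                  ≤⟨ *-monoˡ-≤ N 2048≤N ⟩
  N * N                     ∎)
  where
  open ≤-Reasoning
  regroup : ∀ x → 32 * x * (32 * x) ≡ 1024 * (x * x)
  regroup = solve-∀
  double : ∀ x → 1024 * (x + x) ≡ 2048 * x
  double = solve-∀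

-- Assembling the lower bound.

κ : ℚ
κ = + 1 ℚ./ 256

κ*fromℕ[256*n]≡fromℕ[n] : ∀ n → κ ℚ.* fromℕ (256 * n) ≡ fromℕ n
κ*fromℕ[256*n]≡fromℕ[n] n = begin
  κ ℚ.* fromℕ (256 * n)          ≡⟨ cong (κ ℚ.*_) (fromℕ-* 256 n) ⟩
  κ ℚ.* (fromℕ 256 ℚ.* fromℕ n)  ≡⟨ ℚ.*-assoc κ (fromℕ 256) (fromℕ n) ⟨
  -- `κ * fromℕ 256` evaluates to `1ℚ`.
  1ℚ ℚ.* fromℕ n                 ≡⟨ ℚ.*-identityˡ (fromℕ n) ⟩
  fromℕ n                        ∎
  where open ≡-Reasoning

-- With `N` and `m` the integer parts of `H` and `x`, rounding both factors up reduces the claim to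
-- the inequality `(N + 1)(m + 1) ≤ 256 C` of natural numbers. The scales used are those up to
-- `n = m / 16`.
κHx≤C-constr′ : ∀ {H x} → fromℕ 2048 ℚ.≤ H → log H x → ∀ N m →
  fromℕ N ℚ.≤ H → H ℚ.< fromℕ (suc N) → fromℕ m ℚ.≤ x → x ℚ.< fromℕ (suc m) →
  κ ℚ.* (H ℚ.* x) ℚ.≤ fromℕ (C-constr H)
κHx≤C-constr′ {H} {x} 2048≤H logHx N m N≤H H<1+N m≤x x<1+m = begin
  κ ℚ.* (H ℚ.* x)                     ≤⟨ ℚ.*-monoˡ-≤-nonNeg κ Hx≤ ⟩
  κ ℚ.* fromℕ (256 * C-constr H)      ≡⟨ κ*fromℕ[256*n]≡fromℕ[n] (C-constr H) ⟩
  fromℕ (C-constr H)                  ∎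
  where
  n = m / 16

  16n≤m : 16 * n ≤ m
  16n≤m = ≤-trans (≤-reflexive (*-comm 16 n)) (m/n*n≤m m 16)

  1+m≤16[1+n] : suc m ≤ 16 * suc n
  1+m≤16[1+n] = begin
    suc m                  ≡⟨ cong suc (m≡m%n+[m/n]*n m 16) ⟩
    suc (m % 16) + n * 16  ≤⟨ +-monoˡ-≤ (n * 16) (m%n<n m 16) ⟩
    suc n * 16             ≡⟨ *-comm (suc n) 16 ⟩
    16 * suc n             ∎
    where open ≤-Reasoning

  2048≤N : 2048 ≤ N
  2048≤N = ≤-pred (fromℕ-cancel-< {2048} {suc N} (ℚ.≤-<-trans 2048≤H H<1+N))

  16^n≤1+N : 16 ^ n ≤ suc N
  -- Here `16 ^ n ≤ H + 1 < N + 2` holds in the rationals, and integrality lowers the bound to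
  -- `N + 1`.
  16^n≤1+N = ≤-pred (fromℕ-cancel-< {16 ^ n} {2 + N} (begin-strict
    fromℕ (16 ^ n)       ≤⟨ log⇒c^n≤H+1 {H} {x} 16 n (ℚ.≤-trans (fromℕ-mono-≤ {16 * n} {m} 16n≤m) m≤x) logHx ⟩
    H ℚ.+ 1ℚ             <⟨ ℚ.+-monoˡ-< 1ℚ H<1+N ⟩
    fromℕ (suc N) ℚ.+ 1ℚ ≡⟨ fromℕ-+ (suc N) 1 ⟨
    fromℕ (suc N + 1)    ≡⟨ cong fromℕ (+-comm (suc N) 1) ⟩
    fromℕ (2 + N)        ∎))
    where open ℚ.≤-Reasoning

  [1+N][1+m]≤256C : suc N * suc m ≤ 256 * C-constr H
  [1+N][1+m]≤256C = begin
    -- The constant is `256 = 2 * 16 * 8`: 2 from rounding `H`, 16 from the base, 8 from the size of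
    -- a rectangle.
    (1 + N) * suc m             ≤⟨ *-mono-≤ (+-monoˡ-≤ N (≤-trans (s≤s z≤n) 2048≤N)) 1+m≤16[1+n] ⟩
    (N + N) * (16 * suc n)      ≡⟨ regroup N (suc n) ⟩
    32 * (suc n * N)            ≤⟨ *-monoʳ-≤ 32 ([1+n]N≤8*C-constr {H} N n (16^n≤1+N⇒Wide N n 2048≤N 16^n≤1+N) N≤H) ⟩
    32 * (8 * C-constr H)       ≡⟨ *-assoc 32 8 (C-constr H) ⟨
    256 * C-constr H            ∎
    where
    open ≤-Reasoning
    regroup : ∀ a b → (a + a) * (16 * b) ≡ 32 * (b * a)
    regroup = solve-∀

  open ℚ.≤-Reasoning

  Hx≤ : H ℚ.* x ℚ.≤ fromℕ (256 * C-constr H)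
  Hx≤ = begin
    H ℚ.* x                            ≤⟨ *-mono-≤-nonNeg (ℚ.≤-trans (fromℕ-nonNeg N) N≤H) (fromℕ-nonNeg (suc m)) (ℚ.<⇒≤ H<1+N) (ℚ.<⇒≤ x<1+m) ⟩
    fromℕ (suc N) ℚ.* fromℕ (suc m)    ≡⟨ fromℕ-* (suc N) (suc m) ⟨
    fromℕ (suc N * suc m)              ≤⟨ fromℕ-mono-≤ {suc N * suc m} {256 * C-constr H} [1+N][1+m]≤256C ⟩
    fromℕ (256 * C-constr H)           ∎

κHx≤C-constr : ∀ {H x} → fromℕ 2048 ℚ.≤ H → 0ℚ ℚ.≤ x → log H x → κ ℚ.* (H ℚ.* x) ℚ.≤ fromℕ (C-constr H)
κHx≤C-constr {H} {x} 2048≤H 0≤x logHx =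
  let N , N≤H , H<1+N = ⌊ H ⌋-exists (ℚ.≤-trans (fromℕ-nonNeg 2048) 2048≤H)
      m , m≤x , x<1+m = ⌊ x ⌋-exists 0≤x
  in κHx≤C-constr′ 2048≤H logHx N m N≤H H<1+N m≤x x<1+m

proposition3p2 : C-constr ≫ (λ H → H · log H)
proposition3p2 = κ , fromℕ 2048 , ℚ.positive⁻¹ κ , ℚ.positive⁻¹ (fromℕ 2048) , bound
  where
  open ℚ.≤-Reasoning
  bound : ∀ H → fromℕ 2048 ℚ.≤ H → κ · (H · log H) ≤ᴸ fromℕ (C-constr H)
  bound H 2048≤H y (w , (x , logHx , w≤Hx) , y≤κw) = begin
    y                  ≤⟨ y≤κw ⟩
    κ ℚ.* w            ≤⟨ ℚ.*-monoˡ-≤-nonNeg κ w≤Hx ⟩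
    -- A rational `x` below `log H` may be negative, where the series argument does not apply; then
    -- the left side is at most 0.
    κ ℚ.* (H ℚ.* x)    ≤⟨ [ (λ 0≤x → κHx≤C-constr 2048≤H 0≤x logHx) , nonPositive ]′ (ℚ.≤-total 0ℚ x) ⟩
    fromℕ (C-constr H) ∎
    where
    0≤H = ℚ.≤-trans (fromℕ-nonNeg 2048) 2048≤H
    nonPositive : x ℚ.≤ 0ℚ → κ ℚ.* (H ℚ.* x) ℚ.≤ fromℕ (C-constr H)
    nonPositive x≤0 = begin
      κ ℚ.* (H ℚ.* x)    ≤⟨ ℚ.*-monoˡ-≤-nonNeg κ (ℚ.*-monoˡ-≤-nonNeg H {{ℚ.nonNegative 0≤H}} x≤0) ⟩
      κ ℚ.* (H ℚ.* 0ℚ)   ≡⟨ cong (κ ℚ.*_) (ℚ.*-zeroʳ H) ⟩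
      0ℚ                 ≤⟨ fromℕ-nonNeg (C-constr H) ⟩
      fromℕ (C-constr H) ∎
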